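{- For $n\geq 1$ and $m\geq 2$, the maximum forcing number of $T(2n+1,2m)$ is $F(T(2n+1,2m))=(n+1)m$.
   Context: $T(2n+1,2m)$ is the graph with vertices $(u_i,v_j)$, $i\in\mathbb{Z}_{2m}$, $j\in\mathbb{Z}_{2n+1}$, where $(u_i,v_j)$ is adjacent to $(u_{i+1},v_j)$ and to $(u_i,v_{j+1})$ (the grid graph of the quadriculated torus). For a perfect matching $M$ of a graph $G$, a subset $S\subseteq M$ is a forcing set of $M$ if no other perfect matching of $G$ contains $S$; the forcing number $f(G,M)$ is the minimum size of a forcing set of $M$. The maximum forcing number $F(G)$ is the maximum of $f(G,M)$ over all perfect matchings $M$ of $G$. -}

module Defs where

open import Data.Fin.Base using (Fin; toℕ)
open import Data.Fin.Properties using (toℕ<n; toℕ-fromℕ<)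
open import Data.List.Base using (List; length)
open import Data.List.Relation.Unary.All using (All)
open import Data.Nat.Base
open import Data.Nat.DivMod using (_%_; _mod_; m%n<n; m<n⇒m%n≡m; n%n≡0)
open import Data.Nat.Properties
open import Data.Product.Base using (∃; _×_; _,_)
open import Data.Product using (∃!)
open import Data.Sum.Base using (_⊎_; inj₁; inj₂)
open import Relation.Binary.Bundles using (Setoid)
open import Relation.Binary.Core using (Rel)
open import Relation.Binary.Construct.Closure.Symmetric using (SymClosure; fwd; bwd; symmetric)
open import Relation.Binary.Definitions using (Symmetric)
open import Relation.Binary.PropositionalEquality using (_≡_; _≢_; refl; sym; trans; cong)
open import Relation.Nullary using (¬_; yes; no)
open import Level using (0ℓ)

import Data.List.Membership.Setoid as Membership
import Data.List.Relation.Unary.Unique.Setoid as Uniqueness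

IsMinimum : (ℕ → Set) → ℕ → Set
IsMinimum P k = P k × (∀ j → P j → k ≤ j)

IsMaximum : (ℕ → Set) → ℕ → Set
IsMaximum P k = P k × (∀ j → P j → j ≤ k)

record Graph : Set₁ where
  field
    Vertex  : Set
    Adj     : Rel Vertex 0ℓ
    adj-sym : Symmetric Adj
    irrefl  : ∀ {v} → ¬ Adj v v

-- Unordered pairs: (u , v) and (v , u) are identified.
unorderedPair : Set → Setoid 0ℓ 0ℓ
unorderedPair V = record
  { Carrier       = V × V
  ; _≈_           = _≈_
  ; isEquivalence = record { refl = inj₁ (refl , refl) ; sym = ≈-sym ; trans = ≈-trans }
  }
  where
  _≈_ : Rel (V × V) 0ℓ
  (u , v) ≈ (u′ , v′) = (u ≡ u′ × v ≡ v′) ⊎ (u ≡ v′ × v ≡ u′)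

  ≈-sym : ∀ {e f} → e ≈ f → f ≈ e
  ≈-sym (inj₁ (refl , refl)) = inj₁ (refl , refl)
  ≈-sym (inj₂ (refl , refl)) = inj₂ (refl , refl)

  ≈-trans : ∀ {e f g} → e ≈ f → f ≈ g → e ≈ g
  ≈-trans (inj₁ (refl , refl)) q                    = q
  ≈-trans (inj₂ (refl , refl)) (inj₁ (refl , refl)) = inj₂ (refl , refl)
  ≈-trans (inj₂ (refl , refl)) (inj₂ (refl , refl)) = inj₁ (refl , refl)

module _ (G : Graph) where
  open Graph G
  open Membership (unorderedPair Vertex) using () renaming (_∈_ to _∈ˡ_)
  open Uniqueness (unorderedPair Vertex) using (Unique)

  -- A finite set of edges, listed without repetition (not even with the
  -- endpoints exchanged), so that the length of the list is the cardinality.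
  record EdgeSet : Set where
    field
      edges    : List (Vertex × Vertex)
      adjacent : All (λ (u , v) → Adj u v) edges
      unique   : Unique edges

    size : ℕ
    size = length edges

  open EdgeSet

  infix 4 _∈_ _⊆_ _≐_

  _∈_ : Vertex × Vertex → EdgeSet → Set
  e ∈ S = e ∈ˡ edges S

  _⊆_ : Rel EdgeSet 0ℓ
  S ⊆ S′ = ∀ e → e ∈ S → e ∈ S′

  _≐_ : Rel EdgeSet 0ℓ
  S ≐ S′ = S ⊆ S′ × S′ ⊆ S

  IsPerfectMatching : EdgeSet → Set
  IsPerfectMatching M = ∀ v → ∃! _≡_ λ u → (v , u) ∈ M

  IsForcingSet : EdgeSet → EdgeSet → Set
  IsForcingSet M S = S ⊆ M × (∀ M′ → IsPerfectMatching M′ → S ⊆ M′ → M′ ≐ M)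

  IsForcingNumber : EdgeSet → ℕ → Set
  IsForcingNumber M = IsMinimum λ k → ∃ λ S → IsForcingSet M S × size S ≡ k

  IsMaximumForcingNumber : ℕ → Set
  IsMaximumForcingNumber = IsMaximum λ k → ∃ λ M → IsPerfectMatching M × IsForcingNumber M k

-- i ↦ i + 1 in ℤ/k.
next : ∀ {k} .{{_ : NonZero k}} → Fin k → Fin k
next {k} i = suc (toℕ i) mod k

next-≢ : ∀ {k} .{{_ : NonZero k}} → 2 ≤ k → (i : Fin k) → i ≢ next i
next-≢ {k} 2≤k i i≡next with suc (toℕ i) <? k
... | yes 1+i<k = 1+n≢n (sym (trans toℕi≡ (m<n⇒m%n≡m 1+i<k)))
  where
  toℕi≡ : toℕ i ≡ suc (toℕ i) % k
  toℕi≡ = trans (cong toℕ i≡next) (toℕ-fromℕ< (m%n<n (suc (toℕ i)) k))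
... | no  1+i≮k = <-irrefl 1≡k 2≤k
  where
  toℕi≡ : toℕ i ≡ suc (toℕ i) % k
  toℕi≡ = trans (cong toℕ i≡next) (toℕ-fromℕ< (m%n<n (suc (toℕ i)) k))
  1+i≡k : suc (toℕ i) ≡ k
  1+i≡k = ≤-antisym (toℕ<n i) (≮⇒≥ 1+i≮k)
  i≡0 : toℕ i ≡ 0
  i≡0 = trans toℕi≡ (trans (cong (_% k) 1+i≡k) (n%n≡0 k))
  1≡k : 1 ≡ k
  1≡k = trans (cong suc (sym i≡0)) 1+i≡k

-- T(p, q): the vertex (u_i , v_j) is the pair (i , j) with i ∈ ℤ/q and j ∈ ℤ/p.
-- The lower bounds on p and q exclude loops.
module Torus (p q : ℕ) (2≤p : 2 ≤ p) (2≤q : 2 ≤ q) where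

  instance
    p≢0 : NonZero p
    p≢0 = >-nonZero (<⇒≤ 2≤p)

    q≢0 : NonZero q
    q≢0 = >-nonZero (<⇒≤ 2≤q)

  Step : Rel (Fin q × Fin p) 0ℓ
  Step (i , j) (i′ , j′) = (i′ ≡ next i × j′ ≡ j) ⊎ (i′ ≡ i × j′ ≡ next j)

  ¬step : ∀ {v} → ¬ Step v v
  ¬step {i , j} (inj₁ (i≡next , _)) = next-≢ 2≤q i i≡next
  ¬step {i , j} (inj₂ (_ , j≡next)) = next-≢ 2≤p j j≡next

  T : Graph
  T = record
    { Vertex  = Fin q × Fin p
    ; Adj     = SymClosure Step
    ; adj-sym = symmetric Step
    ; irrefl  = λ { (fwd s) → ¬step s ; (bwd s) → ¬step s }
    }

open Torus public using (T)

2≤2n+1 : ∀ {n} → 1 ≤ n → 2 ≤ 2 * n + 1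
2≤2n+1 {n} 1≤n = ≤-trans (*-monoʳ-≤ 2 1≤n) (m≤m+n (2 * n) 1)

2≤2m : ∀ {m} → 2 ≤ m → 2 ≤ 2 * m
2≤2m {m} 2≤m = ≤-trans 2≤m (m≤m+n m (m + 0))

{-# OPTIONS --safe #-}
module Submission where

-- Upper bound. In every even column 2 c choose the n pairwise non-adjacent vertices in the rows
-- offset c, offset c + 2, …, offset c + 2 n - 2, where offset c is 0 or 1 according to the parity
-- of c. The edges of M avoiding these m n vertices number (n + 1) m, and they force M. Indeed, let f
-- and g be the partner maps of M and of another perfect matching containing them. By finiteness
-- f ∘ g permutes the chosen vertices, so from a chosen x with f x ≢ g x both f x and g x lead
-- on to further such vertices. Two chosen vertices have a common neighbour only if they are two
-- rows apart in the same column or, when m is odd, in the same row on either side of the seam,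
-- the last column. A lowest chosen x with f x ≢ g x can thus continue only upwards and across
-- the seam, where the same happens. Between the two resulting walls f must match the seam
-- vertices upwards in consecutive pairs, so the walls never meet again and climb forever.
--
-- Lower bound. In the matching by all horizontal edges {(2 k , j) , (2 k + 1 , j)}, the edges in rows
-- j and j + 1 form an alternating 4-cycle, so for each k a forcing set induces a vertex cover of the odd
-- cycle of length 2 n + 1, which has at least n + 1 elements.

open import Data.Fin.Base using (Fin; zero; suc; toℕ; fromℕ<; punchOut)
open import Data.Fin.Properties using
  (toℕ<n; toℕ-fromℕ<; toℕ-injective; any?; punchOut-injective; injective⇒≤; *↔×; +↔⊎)
  renaming (_≟_ to _≟ᶠ_)
open import Data.List.Base using (List; []; _∷_; length; map; filter; tabulate; lookup)
open import Data.List.Relation.Unary.All as All using (All; []; _∷_)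
import Data.List.Relation.Unary.All.Properties as All
open import Data.List.Relation.Unary.Any as Any using ()
open import Data.List.Relation.Unary.AllPairs as AllPairs using (AllPairs; []; _∷_)
import Data.List.Relation.Unary.AllPairs.Properties as AllPairs
import Data.List.Relation.Unary.Any.Properties as Any
import Data.List.Membership.Setoid.Properties as Membership
import Data.List.Membership.Propositional as ∈
import Data.List.Membership.Propositional.Properties as ∈
import Data.List.Relation.Unary.Unique.Propositional.Properties as Unique
open import Data.Nat.Base
open import Data.Nat.DivMod using (_%_; m%n<n; m<n⇒m%n≡m; n%n≡0)
open import Data.Nat.Properties
open import Data.Nat.Tactic.RingSolver using (solve-∀)
open import Data.Product.Base using (∃; _×_; _,_; proj₁; proj₂)
open import Data.Product.Function.NonDependent.Propositional using (_×-↔_)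
open import Data.Product.Properties using (≡-dec)
open import Data.Sum.Base as Sum using (_⊎_; inj₁; inj₂)
open import Data.Sum.Function.Propositional using (_⊎-↔_)
open import Function.Base using (_∘_)
open import Function.Bundles using (_↔_; _↣_; mk↣; module Inverse; module Injection)
open import Function.Construct.Composition using (_↔-∘_; _↣-∘_)
open import Function.Construct.Identity using (↔-id)
open import Function.Construct.Symmetry using (↔-sym)
open import Function.Definitions using (Injective)
open import Function.Properties.Inverse using (↔⇒↣)
open import Level using (0ℓ)
open import Relation.Binary.Bundles using (Setoid)
open import Relation.Binary.Core using (Rel)
open import Relation.Binary.Construct.Closure.Symmetric using (SymClosure; fwd; bwd)
open import Relation.Binary.Definitions using (DecidableEquality; Symmetric; tri<; tri≈; tri>)
open import Relation.Binary.PropositionalEquality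
open import Relation.Nullary using (¬_; Dec; yes; no; contradiction)
open import Relation.Nullary.Decidable using (map′; _×-dec_; _⊎-dec_; ¬?)
open import Defs

-- Finite sets

-- If `y` were missed, punching it out would inject `Fin (suc N)` into `Fin N`.
injective⇒surjective : ∀ {N} (h : Fin N → Fin N) → Injective _≡_ _≡_ h → ∀ y → ∃ λ x → h x ≡ y
injective⇒surjective {suc N} h inj y with any? (λ x → h x ≟ᶠ y)
... | yes hit = hit
... | no miss = contradiction (injective⇒≤ {f = λ x → punchOut (y≢h x)} λ {a} {b} eq →
                  inj (punchOut-injective (y≢h a) (y≢h b) eq)) 1+n≰n
  where
  y≢h : ∀ x → y ≢ h x
  y≢h x eq = miss (x , sym eq)

↣-surjective : ∀ {A : Set} {N} → A ↔ Fin N → (h : A → A) → Injective _≡_ _≡_ h → ∀ y → ∃ λ x → h x ≡ y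
↣-surjective A↔ h inj y =
  let x , eq = injective⇒surjective (to ∘ h ∘ from) (from-injective ∘ inj ∘ to-injective) (to y)
  in  from x , to-injective eq
  where
  open Inverse A↔ using (to; from)
  to-injective : Injective _≡_ _≡_ to
  to-injective = Injection.injective (↔⇒↣ A↔)
  from-injective : Injective _≡_ _≡_ from
  from-injective = Injection.injective (↔⇒↣ (↔-sym A↔))

involutive⇒injective : ∀ {A : Set} (f : A → A) → (∀ a → f (f a) ≡ a) → Injective _≡_ _≡_ f
involutive⇒injective f inv {a} {b} eq = trans (sym (inv a)) (trans (cong f eq) (inv b))

-- A finite set mapped into itself by f ∘ g is permuted by it, hence mapped into itself by the inverse g ∘ f.
inverse-closed : ∀ {A V : Set} {N} → A ↔ Fin N → (e : A → V) → Injective _≡_ _≡_ e → (f g : V → V) →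
                 (∀ v → f (f v) ≡ v) → (∀ v → g (g v) ≡ v) →
                 (∀ a → ∃ λ b → e b ≡ f (g (e a))) → ∀ a → ∃ λ b → e b ≡ g (f (e a))
inverse-closed {A} A↔ e e-injective f g f-inv g-inv closed a =
  let b , hb≡a = ↣-surjective A↔ h h-injective a
  in  b , (begin
    e b                ≡⟨ g-inv (e b) ⟨
    g (g (e b))        ≡⟨ cong g (f-inv (g (e b))) ⟨
    g (f (f (g (e b)))) ≡⟨ cong (g ∘ f) (h-spec b) ⟨
    g (f (e (h b)))    ≡⟨ cong (g ∘ f ∘ e) hb≡a ⟩
    g (f (e a))        ∎)
  where
  open ≡-Reasoning
  h : A → A
  h a = proj₁ (closed a)
  h-spec : ∀ a → e (h a) ≡ f (g (e a))
  h-spec a = proj₂ (closed a)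
  h-injective : Injective _≡_ _≡_ h
  h-injective {b} {c} eq = e-injective (involutive⇒injective g g-inv (involutive⇒injective f f-inv
    (trans (sym (h-spec b)) (trans (cong e eq) (h-spec c)))))

↣⇒≤ : ∀ {A B : Set} {a b} → A ↔ Fin a → B ↔ Fin b → A ↣ B → a ≤ b
↣⇒≤ A↔ B↔ f = injective⇒≤ (Injection.injective (↔⇒↣ B↔ ↣-∘ (f ↣-∘ ↔⇒↣ (↔-sym A↔))))

-- `AllPairs` only compares an earlier entry with a later one; symmetry of `R` covers the opposite
-- order.
lookup-unique : ∀ {A : Set} {R : Rel A 0ℓ} → Symmetric R → ∀ {xs} → AllPairs (λ x y → ¬ R x y) xs →
                ∀ i j → R (lookup xs i) (lookup xs j) → i ≡ j
lookup-unique sy (x∉ ∷ u) zero    zero    r = refl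
lookup-unique sy (x∉ ∷ u) zero    (suc j) r = contradiction r (All.lookup x∉ (∈.∈-lookup j))
lookup-unique sy (x∉ ∷ u) (suc i) zero    r = contradiction (sy r) (All.lookup x∉ (∈.∈-lookup i))
lookup-unique sy (x∉ ∷ u) (suc i) (suc j) r = cong suc (lookup-unique sy u i j r)

AllPairs-restrict : ∀ {A : Set} {P : A → Set} {R : Rel A 0ℓ} {xs} → All P xs → AllPairs R xs →
                    AllPairs (λ x y → P x × P y × R x y) xs
AllPairs-restrict []         []       = []
AllPairs-restrict (px ∷ pxs) (r ∷ rs) =
  All.zipWith (λ (py , xRy) → px , py , xRy) (pxs , r) ∷ AllPairs-restrict pxs rs

-- Edge sets

≈-swap : ∀ {V : Set} {u v : V} → Setoid._≈_ (unorderedPair V) (u , v) (v , u)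
≈-swap = inj₂ (refl , refl)

module _ {G : Graph} where
  open Graph G
  open Setoid (unorderedPair Vertex) using () renaming (_≈_ to _≈ᵉ_; sym to ≈ᵉ-sym; trans to ≈ᵉ-trans)
  open EdgeSet using (edges; adjacent; unique; size)

  ∈-swap : ∀ (S : EdgeSet G) {u v} → _∈_ G (u , v) S → _∈_ G (v , u) S
  ∈-swap S = Any.map (≈ᵉ-trans ≈-swap)

  ∈-adjacent : ∀ (S : EdgeSet G) {u v} → _∈_ G (u , v) S → Adj u v
  ∈-adjacent S e∈ with All.lookupAny (adjacent S) e∈
  ... | a , inj₁ (u≡ , v≡) = subst₂ Adj (sym u≡) (sym v≡) a
  ... | a , inj₂ (u≡ , v≡) = adj-sym (subst₂ Adj (sym v≡) (sym u≡) a)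

  ∈-lookup : ∀ (S : EdgeSet G) i → _∈_ G (lookup (edges S) i) S
  ∈-lookup S i = Any.map inj (∈.∈-lookup i)
    where
    inj : ∀ {e f : Vertex × Vertex} → e ≡ f → e ≈ᵉ f
    inj refl = inj₁ (refl , refl)

  -- Edges that differ even up to orientation occupy distinct positions in the list of `S`.
  ∈⇒≤size : ∀ (S : EdgeSet G) {A : Set} {N} → A ↔ Fin N → (e : A → Vertex × Vertex) → (∀ a → _∈_ G (e a) S) →
            (∀ {a b} → e a ≈ᵉ e b → a ≡ b) → N ≤ size S
  ∈⇒≤size S A↔ e e∈ inj = ↣⇒≤ A↔ (↔-id _) (mk↣ {to = λ a → Any.index (e∈ a)} λ {a} {b} eq →
    inj (≈ᵉ-trans (Any.lookup-index (e∈ a))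
          (subst (λ i → lookup (edges S) i ≈ᵉ e b) (sym eq) (≈ᵉ-sym (Any.lookup-index (e∈ b))))))

-- Perfect matchings and their partner maps

module Matching (G : Graph) {M : EdgeSet G} (perfect : IsPerfectMatching G M) where
  open Graph G

  partner : Vertex → Vertex
  partner v = proj₁ (perfect v)

  partner-∈ : ∀ v → _∈_ G (v , partner v) M
  partner-∈ v = proj₁ (proj₂ (perfect v))

  partner-unique : ∀ {v u} → _∈_ G (v , u) M → partner v ≡ u
  partner-unique {v} = proj₂ (proj₂ (perfect v))

  partner-involutive : ∀ v → partner (partner v) ≡ v
  partner-involutive v = partner-unique (∈-swap M (partner-∈ v))

  partner-adjacent : ∀ v → Adj v (partner v)
  partner-adjacent v = ∈-adjacent M (partner-∈ v)

module _ (G : Graph) {M M′ : EdgeSet G} (pm : IsPerfectMatching G M) (pm′ : IsPerfectMatching G M′) where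
  private
    module M  = Matching G {M} pm
    module M′ = Matching G {M′} pm′

  same-partner⇒≐ : (∀ v → M.partner v ≡ M′.partner v) → _≐_ G M′ M
  same-partner⇒≐ eq =
      (λ (u , v) e∈ → subst (λ w → _∈_ G (u , w) M)  (trans (eq u) (M′.partner-unique e∈)) (M.partner-∈ u))
    , (λ (u , v) e∈ → subst (λ w → _∈_ G (u , w) M′) (trans (sym (eq u)) (M.partner-unique e∈)) (M′.partner-∈ u))

  ≐⇒same-partner : _≐_ G M′ M → ∀ v → M.partner v ≡ M′.partner v
  ≐⇒same-partner (_ , M⊆M′) v = sym (M′.partner-unique (M⊆M′ _ (M.partner-∈ v)))

-- `V↔` supplies both the enumeration behind the edge list and the codes that order the two ends of
-- an edge.
module FromInvolution (G : Graph) {N : ℕ} (V↔ : Graph.Vertex G ↔ Fin N)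
  (f : Graph.Vertex G → Graph.Vertex G) (involutive : ∀ v → f (f v) ≡ v) (adj : ∀ v → Graph.Adj G v (f v)) where
  open Graph G
  open Inverse V↔ using (to; from)

  private
    code : Vertex → ℕ
    code = toℕ ∘ to

    code-injective : ∀ {u v} → code u ≡ code v → u ≡ v
    code-injective = Injection.injective (↔⇒↣ V↔) ∘ toℕ-injective

    -- Each matched pair is listed once, from its endpoint of smaller code.
    First : Vertex → Set
    First v = code v < code (f v)

    First? : ∀ v → Dec (First v)
    First? v = code v <? code (f v)

    vertices firsts : List Vertex
    vertices = tabulate from
    firsts   = filter First? vertices

    firsts-unique : AllPairs (λ u v → First u × First v × u ≢ v) firsts
    firsts-unique = AllPairs-restrict (All.all-filter First? vertices)
      (AllPairs.filter⁺ First? (Unique.tabulate⁺ (Injection.injective (↔⇒↣ (↔-sym V↔)))))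

    ∈-firsts : ∀ {v} → First v → v ∈.∈ firsts
    ∈-firsts {v} = ∈.∈-filter⁺ First?
      (subst (λ w → w ∈.∈ vertices) (Inverse.strictlyInverseʳ V↔ v) (∈.∈-tabulate⁺ (to v)))

  matching : EdgeSet G
  matching = record
    { edges    = map (λ v → v , f v) firsts
    ; adjacent = All.map⁺ (All.universal adj firsts)
    ; unique   = AllPairs.map⁺ (AllPairs.map distinct firsts-unique)
    }
    where
    distinct : ∀ {u v} → First u × First v × u ≢ v → ¬ Setoid._≈_ (unorderedPair Vertex) (u , f u) (v , f v)
    distinct (_ , _ , u≢v) (inj₁ (u≡v , _)) = u≢v u≡v
    -- Here `u` and `v` are partners, and each would have the smaller code.
    distinct {_} {v} (u< , v< , _) (inj₂ (refl , ffv≡v)) = <-asym v< (subst (λ w → code (f v) < code w) ffv≡v u<)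

  matched : ∀ v → _∈_ G (v , f v) matching
  matched v with <-cmp (code v) (code (f v))
  ... | tri< v< _ _ = Any.map⁺ (Any.map (λ { refl → inj₁ (refl , refl) }) (∈-firsts v<))
  ... | tri≈ _ eq _ = contradiction (subst (Adj v) (sym (code-injective eq)) (adj v)) irrefl
  ... | tri> _ _ v> = Any.map⁺ (Any.map (λ { refl → inj₂ (sym (involutive v) , refl) })
                        (∈-firsts (subst (code (f v) <_) (cong code (sym (involutive v))) v>)))

  matched-unique : ∀ {v u} → _∈_ G (v , u) matching → f v ≡ u
  matched-unique e∈ with Any.satisfied (Any.map⁻ e∈)
  ... | w , inj₁ (refl , refl) = refl
  ... | w , inj₂ (refl , refl) = involutive w

  perfect : IsPerfectMatching G matching
  perfect v = f v , matched v , matched-unique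

-- Walks on cycles and tori

-- Cyclic successor on representatives, split by whether it wraps, so that rows and columns can be
-- compared as natural numbers.
data Next (k a b : ℕ) : Set where
  step : b ≡ suc a → Next k a b
  wrap : suc a ≡ k → b ≡ 0 → Next k a b

toℕ-next : ∀ {k} .{{_ : NonZero k}} (i : Fin k) → Next k (toℕ i) (toℕ (next i))
toℕ-next {k} i with suc (toℕ i) <? k
... | yes 1+i<k = step (trans (toℕ-fromℕ< (m%n<n (suc (toℕ i)) k)) (m<n⇒m%n≡m 1+i<k))
... | no  1+i≮k = wrap 1+i≡k (trans (toℕ-fromℕ< (m%n<n (suc (toℕ i)) k)) (trans (cong (_% k) 1+i≡k) (n%n≡0 k)))
  where
  1+i≡k : suc (toℕ i) ≡ k
  1+i≡k = ≤-antisym (toℕ<n i) (≮⇒≥ 1+i≮k)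

Neighbour : ℕ → ℕ → ℕ → Set
Neighbour k = SymClosure (Next k)

-- Paths a – b – d with a ≢ d on the cycle 0, 1, …, k - 1; the last three have an edge {k - 1, 0}.
data Path (k a b d : ℕ) : Set where
  up      : b ≡ suc a → d ≡ suc b → Path k a b d
  down    : a ≡ suc b → b ≡ suc d → Path k a b d
  upʷ     : b ≡ suc a → suc b ≡ k → d ≡ 0 → Path k a b d
  downʷ   : b ≡ suc d → suc b ≡ k → a ≡ 0 → Path k a b d
  through : b ≡ 0 → suc a ≡ k ⊎ suc d ≡ k → Path k a b d

path : ∀ {k a b d} → a < k → d < k → a ≢ d → Neighbour k a b → Neighbour k b d → Path k a b d
path a< d< a≢d (fwd (step p))   (fwd (step r))   = up p r
path a< d< a≢d (fwd (step p))   (fwd (wrap q r)) = upʷ p q r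
path a< d< a≢d (fwd (wrap p q)) (fwd r)          = through q (inj₁ p)
path a< d< a≢d (fwd (step p))   (bwd (step r))   = contradiction (suc-injective (trans (sym p) r)) a≢d
-- Both ends would precede `b`, which `a≢d` excludes; `through` absorbs the case without further
-- arithmetic.
path a< d< a≢d (fwd p)          (bwd (wrap q r)) = through r (inj₂ q)
path a< d< a≢d (fwd (wrap p q)) (bwd r)          = through q (inj₁ p)
path a< d< a≢d (bwd (step p))   (fwd (step r))   = contradiction (trans p (sym r)) a≢d
path a< d< a≢d (bwd (step p))   (fwd (wrap q r)) = contradiction (trans p q) (<⇒≢ a<)
path a< d< a≢d (bwd (wrap p q)) (fwd (step r))   = contradiction (trans r p) (<⇒≢ d<)
path a< d< a≢d (bwd (wrap p q)) (fwd (wrap r s)) = contradiction (trans q (sym s)) a≢d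
path a< d< a≢d (bwd (step p))   (bwd (step r))   = down p r
path a< d< a≢d (bwd (wrap p q)) (bwd (step r))   = downʷ r p q
path a< d< a≢d (bwd p)          (bwd (wrap q r)) = through r (inj₂ q)

-- The offset of the chosen rows in the c-th chosen column alternates along the columns.
offset : ℕ → ℕ
offset 0             = 0
offset 1             = 1
offset (suc (suc c)) = offset c

offset≤1 : ∀ c → offset c ≤ 1
offset≤1 0             = z≤n
offset≤1 1             = ≤-refl
offset≤1 (suc (suc c)) = offset≤1 c

-- The two offsets are 0 and 1 in some order, so an even number would equal an odd one.
offset-alternates : ∀ c k l → offset c + 2 * k ≢ offset (suc c) + 2 * l
offset-alternates 0             k l eq = even≢odd k l eq
offset-alternates 1             k l eq = even≢odd l k (sym eq)
offset-alternates (suc (suc c)) k l eq = offset-alternates c k l eq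

-- Pairing `2 k` with `2 k + 1`

swap : ℕ → ℕ
swap 0             = 1
swap 1             = 0
swap (suc (suc i)) = suc (suc (swap i))

swap-involutive : ∀ i → swap (swap i) ≡ i
swap-involutive 0             = refl
swap-involutive 1             = refl
swap-involutive (suc (suc i)) = cong (2 +_) (swap-involutive i)

swap-adjacent : ∀ i → swap i ≡ suc i ⊎ i ≡ suc (swap i)
swap-adjacent 0             = inj₁ refl
swap-adjacent 1             = inj₂ refl
swap-adjacent (suc (suc i)) = Sum.map (cong (2 +_)) (cong (2 +_)) (swap-adjacent i)

swap-< : ∀ m {i} → i < 2 * m → swap i < 2 * m
swap-< (suc m) {0}           _  = subst (1 <_) (sym (*-suc 2 m)) (s≤s (s≤s z≤n))
swap-< (suc m) {1}           _  = z<s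
swap-< (suc m) {suc (suc i)} i< =
  subst (2 + swap i <_) (sym (*-suc 2 m)) (s≤s (s≤s (swap-< m (s≤s⁻¹ (s≤s⁻¹ (subst (2 + i <_) (*-suc 2 m) i<))))))

half-swap : ∀ i → ⌊ swap i /2⌋ ≡ ⌊ i /2⌋
half-swap 0             = refl
half-swap 1             = refl
half-swap (suc (suc i)) = cong suc (half-swap i)

half-even : ∀ k → ⌊ 2 * k /2⌋ ≡ k
half-even zero    = refl
half-even (suc k) = trans (cong ⌊_/2⌋ (*-suc 2 k)) (cong suc (half-even k))

half-odd : ∀ k → ⌊ suc (2 * k) /2⌋ ≡ k
half-odd zero    = refl
half-odd (suc k) = trans (cong (⌊_/2⌋ ∘ suc) (*-suc 2 k)) (cong suc (half-odd k))

swap-even : ∀ k → swap (2 * k) ≡ suc (2 * k)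
swap-even zero    = refl
swap-even (suc k) rewrite *-suc 2 k = cong (2 +_) (swap-even k)

half⁻¹ : ∀ i → i ≡ 2 * ⌊ i /2⌋ ⊎ i ≡ swap (2 * ⌊ i /2⌋)
half⁻¹ 0             = inj₁ refl
half⁻¹ 1             = inj₂ refl
half⁻¹ (suc (suc i)) rewrite *-suc 2 ⌊ i /2⌋ = Sum.map (cong (2 +_)) (cong (2 +_)) (half⁻¹ i)

≡-next : ∀ {k} .{{_ : NonZero k}} {i j : Fin k} → toℕ j ≡ suc (toℕ i) → j ≡ next i
≡-next {i = i} {j} eq with toℕ-next i
... | step eq′        = toℕ-injective (trans eq (sym eq′))
... | wrap 1+i≡k _ = contradiction (trans eq 1+i≡k) (<⇒≢ (toℕ<n j))

-- Vertex covers of odd cycles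

edge-cover : ∀ {k} .{{_ : NonZero k}} {C : Fin k → Set} → (∀ j → C j ⊎ C (next j)) →
             ∀ i → suc i < k → ∃ λ j → C j × (toℕ j ≡ i ⊎ toℕ j ≡ suc i)
edge-cover cover i 1+i<k with fromℕ< (<⇒≤ 1+i<k) in eq
... | a with cover a | trans (cong toℕ (sym eq)) (toℕ-fromℕ< _)
...   | inj₁ a∈ | a≡i = a , a∈ , inj₁ a≡i
...   | inj₂ b∈ | a≡i with toℕ-next a
...     | step b≡     = next a , b∈ , inj₂ (trans b≡ (cong suc a≡i))
...     | wrap 1+a≡ _ = contradiction (trans (cong suc (sym a≡i)) 1+a≡) (<⇒≢ 1+i<k)

-- One of the last and the first vertex belongs to the cover, and each of the n consecutive pairs
-- formed by the remaining vertices contains another element, recovered from its key.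
odd-cycle-cover : ∀ n .{{_ : NonZero (2 * n + 1)}} {C : Fin (2 * n + 1) → Set} → (∀ j → Dec (C j)) →
                  (∀ j → C j ⊎ C (next j)) →
                  ∃ λ (key : Fin (2 * n + 1) → ℕ) → ∀ (l : Fin (n + 1)) → ∃ λ j → C j × key j ≡ toℕ l
odd-cycle-cover n {C} C? cover with C? (fromℕ< (≤-reflexive (+-comm 1 (2 * n))))
-- Vertex `2 n` gets key `n`; for `l < n` the pair `2 l`, `2 l + 1` yields key `l`.
... | yes last∈ = (λ j → ⌊ toℕ j /2⌋) , choose
  where
  choose : (l : Fin (n + 1)) → ∃ λ j → C j × ⌊ toℕ j /2⌋ ≡ toℕ l
  choose l with toℕ l <? n
  ... | no  l≮n = _ , last∈ , trans (cong ⌊_/2⌋ (toℕ-fromℕ< _)) (trans (half-even n)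
                    (≤-antisym (≮⇒≥ l≮n) (s≤s⁻¹ (subst (toℕ l <_) (+-comm n 1) (toℕ<n l)))))
  ... | yes l<n with edge-cover cover (2 * toℕ l) (subst (suc (2 * toℕ l) <_) (+-comm 1 (2 * n)) (s≤s (*-monoʳ-< 2 l<n)))
  ...   | j , j∈ , inj₁ eq = j , j∈ , trans (cong ⌊_/2⌋ eq) (half-even (toℕ l))
  ...   | j , j∈ , inj₂ eq = j , j∈ , trans (cong ⌊_/2⌋ eq) (half-odd (toℕ l))
-- Now vertex 0 is in the cover and gets key 0; the pair `2 k + 1`, `2 k + 2` yields key `k + 1`.
... | no  last∉ = (λ j → ⌈ toℕ j /2⌉) , choose
  where
  last : Fin (2 * n + 1)
  last = fromℕ< (≤-reflexive (+-comm 1 (2 * n)))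
  toℕ-next-last : toℕ (next last) ≡ 0
  toℕ-next-last with toℕ-next last
  ... | wrap _ eq = eq
  ... | step eq   = contradiction (trans eq (trans (cong suc (toℕ-fromℕ< _)) (+-comm 1 (2 * n)))) (<⇒≢ (toℕ<n (next last)))
  choose : (l : Fin (n + 1)) → ∃ λ j → C j × ⌈ toℕ j /2⌉ ≡ toℕ l
  choose l with toℕ l | toℕ<n l
  ... | zero  | _ with cover last
  ...   | inj₁ last∈ = contradiction last∈ last∉
  ...   | inj₂ 0∈    = next last , 0∈ , cong ⌈_/2⌉ toℕ-next-last
  choose l | suc k | k<n
    with edge-cover cover (suc (2 * k)) (subst₂ _<_ (*-suc 2 k) (+-comm 1 (2 * n))
           (s≤s (*-monoʳ-≤ 2 (s≤s⁻¹ (subst (suc k <_) (+-comm n 1) k<n)))))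
  ...   | j , j∈ , inj₁ eq = j , j∈ , trans (cong ⌈_/2⌉ eq) (cong suc (half-even k))
  ...   | j , j∈ , inj₂ eq = j , j∈ , trans (cong ⌈_/2⌉ eq) (cong suc (half-odd k))

-- The torus in coordinates

module Grid (n m : ℕ) (1≤n : 1 ≤ n) (2≤m : 2 ≤ m) where

  p q : ℕ
  p = 2 * n + 1
  q = 2 * m

  open Torus p q (2≤2n+1 1≤n) (2≤2m 2≤m) using (p≢0; q≢0) public

  G : Graph
  G = T p q (2≤2n+1 1≤n) (2≤2m 2≤m)

  open Graph G using (Vertex; Adj) public

  col row : Vertex → ℕ
  col (i , _) = toℕ i
  row (_ , j) = toℕ j

  col< : ∀ v → col v < q
  col< (i , _) = toℕ<n i

  row< : ∀ v → row v < p
  row< (_ , j) = toℕ<n j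

  vertex-≡ : ∀ {u v} → col u ≡ col v → row u ≡ row v → u ≡ v
  vertex-≡ c r = cong₂ _,_ (toℕ-injective c) (toℕ-injective r)

  _≟ᵛ_ : DecidableEquality Vertex
  _≟ᵛ_ = ≡-dec _≟ᶠ_ _≟ᶠ_

  Vertex↔ : Vertex ↔ Fin (q * p)
  Vertex↔ = ↔-sym *↔×

  1+r≡p⇒r≡2n : ∀ {r} → suc r ≡ p → r ≡ 2 * n
  1+r≡p⇒r≡2n eq = suc-injective (trans eq (+-comm (2 * n) 1))

  2n<p : 2 * n < p
  2n<p = ≤-reflexive (+-comm 1 (2 * n))

  data Neighbours (u v : Vertex) : Set where
    horizontal : Neighbour q (col u) (col v) → row v ≡ row u → Neighbours u v
    vertical   : Neighbour p (row u) (row v) → col v ≡ col u → Neighbours u v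

  neighbours : ∀ {u v} → Adj u v → Neighbours u v
  neighbours {u} (fwd (inj₁ (refl , refl))) = horizontal (fwd (toℕ-next (proj₁ u))) refl
  neighbours {u} (fwd (inj₂ (refl , refl))) = vertical (fwd (toℕ-next (proj₂ u))) refl
  neighbours {_} {v} (bwd (inj₁ (refl , refl))) = horizontal (bwd (toℕ-next (proj₁ v))) refl
  neighbours {_} {v} (bwd (inj₂ (refl , refl))) = vertical (bwd (toℕ-next (proj₂ v))) refl

  -- The chosen vertices

  Index : Set
  Index = Fin m × Fin n

  Index↔ : Index ↔ Fin (m * n)
  Index↔ = ↔-sym *↔×

  -- Row `2 n` thus stays free of chosen vertices, which excludes adjacency across the vertical
  -- wrap.
  chosen-row< : ∀ c {k} → k < n → offset c + 2 * k < 2 * n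
  chosen-row< c {k} k<n = begin-strict
    offset c + 2 * k ≤⟨ +-monoˡ-≤ (2 * k) (offset≤1 c) ⟩
    1 + 2 * k        <⟨ n<1+n _ ⟩
    2 + 2 * k        ≡⟨ *-suc 2 k ⟨
    2 * suc k        ≤⟨ *-monoʳ-≤ 2 k<n ⟩
    2 * n            ∎
    where open ≤-Reasoning

  chosen : Index → Vertex
  chosen (c , k) = fromℕ< (*-monoʳ-< 2 (toℕ<n c))
                 , fromℕ< (<-trans (chosen-row< (toℕ c) (toℕ<n k)) 2n<p)

  Chosen : Vertex → Set
  Chosen v = ∃ λ a → chosen a ≡ v

  chosen? : ∀ v → Dec (Chosen v)
  chosen? v = map′ (λ (c , k , eq) → (c , k) , eq) (λ ((c , k) , eq) → c , k , eq)
                (any? λ c → any? λ k → chosen (c , k) ≟ᵛ v)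

  record Position (v : Vertex) : Set where
    field
      c k : ℕ
      col≡ : col v ≡ 2 * c
      row≡ : row v ≡ offset c + 2 * k
      k<n  : k < n

  position : ∀ {v} → Chosen v → Position v
  position ((c , k) , refl) = record
    { c = toℕ c ; k = toℕ k ; col≡ = toℕ-fromℕ< _ ; row≡ = toℕ-fromℕ< _ ; k<n = toℕ<n k }

  chosen-injective : Injective _≡_ _≡_ chosen
  chosen-injective {c , k} {c′ , k′} eq = cong₂ _,_ c≡c′ (toℕ-injective (*-cancelˡ-≡ _ _ 2 2k≡2k′))
    where
    c≡c′ : c ≡ c′
    c≡c′ = toℕ-injective (*-cancelˡ-≡ _ _ 2
      (trans (sym (toℕ-fromℕ< _)) (trans (cong col eq) (toℕ-fromℕ< _))))
    2k≡2k′ : 2 * toℕ k ≡ 2 * toℕ k′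
    2k≡2k′ = +-cancelˡ-≡ (offset (toℕ c)) _ _
      (trans (sym (toℕ-fromℕ< _)) (trans (cong row eq) (trans (toℕ-fromℕ< _)
        (cong (λ i → offset (toℕ i) + 2 * toℕ k′) (sym c≡c′)))))

  Chosen-row< : ∀ {v} → Chosen v → row v < 2 * n
  Chosen-row< v∈ = subst (_< 2 * n) (sym row≡) (chosen-row< c k<n)
    where open Position (position v∈)

  Chosen-col-even : ∀ {v} → Chosen v → ∀ l → col v ≢ suc (2 * l)
  Chosen-col-even v∈ l eq = even≢odd c l (trans (sym col≡) eq)
    where open Position (position v∈)

  Chosen-col≢1+ : ∀ {v w} → Chosen v → Chosen w → col v ≢ suc (col w)
  Chosen-col≢1+ v∈ w∈ eq = Chosen-col-even v∈ c (trans eq (cong suc col≡))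
    where open Position (position w∈)

  Chosen-1+col≢q : ∀ {v} → Chosen v → suc (col v) ≢ q
  Chosen-1+col≢q v∈ eq = even≢odd m c (sym (trans (cong suc (sym col≡)) eq))
    where open Position (position v∈)

  Chosen-row≢1+ : ∀ {v w} → Chosen v → Chosen w → col v ≡ col w → row v ≢ suc (row w)
  Chosen-row≢1+ {v} {w} v∈ w∈ c≡ eq
    with position v∈ | position w∈
  ... | record { c = c ; k = k ; col≡ = cv ; row≡ = rv } | record { c = d ; k = l ; col≡ = cw ; row≡ = rw }
    with refl ← *-cancelˡ-≡ c d 2 (trans (sym cv) (trans c≡ cw))
    = even≢odd k l (+-cancelˡ-≡ (offset c) _ _ (begin
        offset c + 2 * k       ≡⟨ rv ⟨
        row v                  ≡⟨ eq ⟩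
        suc (row w)            ≡⟨ cong suc rw ⟩
        suc (offset c + 2 * l) ≡⟨ +-suc (offset c) _ ⟨
        offset c + suc (2 * l) ∎))
    where open ≡-Reasoning

  Chosen-columns-alternate : ∀ {v w} → Chosen v → Chosen w → col w ≡ 2 + col v → row w ≢ row v
  Chosen-columns-alternate {v} {w} v∈ w∈ c≡ eq
    with position v∈ | position w∈
  ... | record { c = c ; k = k ; col≡ = cv ; row≡ = rv } | record { c = d ; k = l ; col≡ = cw ; row≡ = rw }
    with refl ← *-cancelˡ-≡ d (suc c) 2 (trans (sym cw) (trans c≡ (trans (cong (2 +_) cv) (sym (*-suc 2 c)))))
    = offset-alternates c k l (trans (sym rv) (trans (sym eq) rw))

  -- Row 0 requires offset 0, and then all chosen rows of the column are even, unlike row `2 n - 1`.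
  -- Hence row `2 n` joins no two chosen vertices vertically.
  Chosen-row-top : ∀ {v w} → Chosen v → Chosen w → col v ≡ col w → suc (suc (row v)) ≡ p → row w ≢ 0
  Chosen-row-top {v} {w} v∈ w∈ c≡ top eq
    with position v∈ | position w∈
  ... | record { c = c ; k = k ; col≡ = cv ; row≡ = rv } | record { c = d ; k = l ; col≡ = cw ; row≡ = rw }
    with refl ← *-cancelˡ-≡ c d 2 (trans (sym cv) (trans c≡ cw))
    = even≢odd n k (begin
        2 * n            ≡⟨ 1+r≡p⇒r≡2n top ⟨
        suc (row v)      ≡⟨ cong suc rv ⟩
        suc (offset c + 2 * k) ≡⟨ cong (λ o → suc (o + 2 * k)) (m+n≡0⇒m≡0 (offset c) (trans (sym rw) eq)) ⟩
        suc (2 * k)      ∎)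
    where open ≡-Reasoning

  Chosen-not-consecutive : ∀ {v w} → Chosen v → Chosen w → ¬ Neighbour q (col v) (col w)
  Chosen-not-consecutive v∈ w∈ (fwd (step eq))   = Chosen-col≢1+ w∈ v∈ eq
  Chosen-not-consecutive v∈ w∈ (fwd (wrap eq _)) = Chosen-1+col≢q v∈ eq
  Chosen-not-consecutive v∈ w∈ (bwd (step eq))   = Chosen-col≢1+ v∈ w∈ eq
  Chosen-not-consecutive v∈ w∈ (bwd (wrap eq _)) = Chosen-1+col≢q w∈ eq

  Chosen-independent : ∀ {v w} → Chosen v → Chosen w → ¬ Adj v w
  Chosen-independent v∈ w∈ adj with neighbours adj
  ... | horizontal a _                 = Chosen-not-consecutive v∈ w∈ a
  ... | vertical (fwd (step eq)) c≡    = Chosen-row≢1+ w∈ v∈ c≡ eq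
  ... | vertical (fwd (wrap eq _)) _   = <⇒≢ (Chosen-row< v∈) (1+r≡p⇒r≡2n eq)
  ... | vertical (bwd (step eq)) c≡    = Chosen-row≢1+ v∈ w∈ (sym c≡) eq
  ... | vertical (bwd (wrap eq _)) _   = <⇒≢ (Chosen-row< w∈) (1+r≡p⇒r≡2n eq)

  data Move (x y z : Vertex) : Set where
    up    : col y ≡ col x → row y ≡ suc (row x) → col z ≡ col x → row z ≡ 2 + row x → Move x y z
    down  : col y ≡ col x → row x ≡ suc (row y) → 2 + row z ≡ row x → Move x y z
    seamʳ : 2 + col x ≡ q → suc (col y) ≡ q → col z ≡ 0 → row y ≡ row x → row z ≡ row x → Move x y z
    seamˡ : col x ≡ 0 → suc (col y) ≡ q → 2 + col z ≡ q → row y ≡ row x → row z ≡ row x → Move x y z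

  -- A walk with a turn would join consecutive columns, but chosen columns are even. Among straight
  -- walks, alternating offsets leave only the horizontal ones across the seam; `Chosen-row-top` and
  -- the empty row `2 n` exclude vertical wraps.
  move : ∀ {x y z} → Chosen x → Chosen z → x ≢ z → Adj x y → Adj y z → Move x y z
  move {x} {y} {z} x∈ z∈ x≢z xy yz with neighbours xy | neighbours yz
  ... | horizontal a r | horizontal b s
    with path (col< x) (col< z) (λ c → x≢z (vertex-≡ c (sym (trans s r)))) a b
  ...   | up c d      = contradiction (trans s r) (Chosen-columns-alternate x∈ z∈ (trans d (cong suc c)))
  ...   | down c d    = contradiction (sym (trans s r)) (Chosen-columns-alternate z∈ x∈ (trans c (cong suc d)))
  ...   | upʷ c d e   = seamʳ (trans (cong suc (sym c)) d) d e r (trans s r)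
  ...   | downʷ c d e = seamˡ e d (trans (cong suc (sym c)) d) r (trans s r)
  ...   | through _ (inj₁ e) = contradiction e (Chosen-1+col≢q x∈)
  ...   | through _ (inj₂ e) = contradiction e (Chosen-1+col≢q z∈)
  move {x} {y} {z} x∈ z∈ x≢z xy yz | vertical a c | vertical b d
    with path (row< x) (row< z) (λ r → x≢z (vertex-≡ (sym (trans d c)) r)) a b
  ...   | up r s      = up c r (trans d c) (trans s (cong suc r))
  ...   | down r s    = down c r (sym (trans r (cong suc s)))
  ...   | upʷ r s e   = contradiction e (Chosen-row-top x∈ z∈ (sym (trans d c)) (trans (cong suc (sym r)) s))
  ...   | downʷ r s e = contradiction e (Chosen-row-top z∈ x∈ (trans d c) (trans (cong suc (sym r)) s))
  ...   | through _ (inj₁ e) = contradiction (1+r≡p⇒r≡2n e) (<⇒≢ (Chosen-row< x∈))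
  ...   | through _ (inj₂ e) = contradiction (1+r≡p⇒r≡2n e) (<⇒≢ (Chosen-row< z∈))
  move x∈ z∈ x≢z xy yz | horizontal a r | vertical b c =
    contradiction (subst (Neighbour q _) (sym c) a) (Chosen-not-consecutive x∈ z∈)
  move x∈ z∈ x≢z xy yz | vertical a c | horizontal b r =
    contradiction (subst (λ i → Neighbour q i _) c b) (Chosen-not-consecutive x∈ z∈)

  -- Exchanging perfect matchings

  -- Involutions f and g that agree off the f-edges meeting the chosen vertices are the partner
  -- maps of two perfect matchings containing the same unchosen edges.
  module Exchange (f g : Vertex → Vertex)
    (f-involutive : ∀ v → f (f v) ≡ v) (g-involutive : ∀ v → g (g v) ≡ v)
    (f-adjacent : ∀ v → Adj v (f v)) (g-adjacent : ∀ v → Adj v (g v))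
    (agree : ∀ v → ¬ Chosen v → ¬ Chosen (f v) → f v ≡ g v) where

    f-injective : Injective _≡_ _≡_ f
    f-injective = involutive⇒injective f f-involutive

    g-injective : Injective _≡_ _≡_ g
    g-injective = involutive⇒injective g g-involutive

    -- By independence `g x` is not chosen. If `f (g x)` were not chosen either, `agree` would make
    -- it `g (g x)`, that is, the chosen `x`.
    fg-chosen : ∀ {x} → Chosen x → Chosen (f (g x))
    fg-chosen {x} x∈ with chosen? (f (g x))
    ... | yes fgx∈ = fgx∈
    ... | no  fgx∉ = subst Chosen (sym fgx≡x) x∈
      where
      fgx≡x : f (g x) ≡ x
      fgx≡x = trans (agree (g x) (λ gx∈ → Chosen-independent x∈ gx∈ (g-adjacent x)) fgx∉) (g-involutive x)

    -- `agree` concerns `f`-edges only, so the argument for `fg-chosen` cannot be mirrored;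
    -- finiteness supplies this direction.
    gf-chosen : ∀ {x} → Chosen x → Chosen (g (f x))
    gf-chosen (a , refl) = inverse-closed Index↔ chosen chosen-injective f g f-involutive g-involutive
      (λ b → fg-chosen (b , refl)) a

    Defect : Vertex → Set
    Defect x = Chosen x × f x ≢ g x

    Side : Vertex → Vertex → Set
    Side x y = f x ≡ y ⊎ g x ≡ y

    -- Two steps of the alternating walk from `x` through `y` to the next defect `z`; `fy` records
    -- which of the two steps is an `f`-edge.
    record Crossing (x y : Vertex) : Set where
      field
        {z}    : Vertex
        defect : Defect z
        side   : Side z y
        fy     : f y ≡ x ⊎ f y ≡ z
        moves  : Move x y z

      fy-chosen : Chosen x → Chosen (f y)
      fy-chosen x∈ with fy
      ... | inj₁ eq = subst Chosen (sym eq) x∈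
      ... | inj₂ eq = subst Chosen (sym eq) (proj₁ defect)

    -- Returning to `x` would give `f x ≡ g x`; agreement of `f` and `g` at `z` would give `z ≡ x`.
    crossing : ∀ {x y} → Defect x → Side x y → Crossing x y
    crossing {x} (x∈ , fx≢gx) (inj₁ refl) = record
      { defect = z∈ , λ fz≡gz → x≢z (f-injective (sym (trans fz≡gz (g-involutive (f x)))))
      ; side   = inj₂ (g-involutive (f x))
      ; fy     = inj₁ (f-involutive x)
      ; moves  = move x∈ z∈ x≢z (f-adjacent x) (g-adjacent (f x))
      }
      where
      z∈ : Chosen (g (f x))
      z∈ = gf-chosen x∈
      x≢z : x ≢ g (f x)
      x≢z eq = fx≢gx (g-injective (trans (sym eq) (sym (g-involutive x))))
    crossing {x} (x∈ , fx≢gx) (inj₂ refl) = record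
      { defect = z∈ , λ fz≡gz → x≢z (g-injective (trans (sym (f-involutive (g x))) fz≡gz))
      ; side   = inj₁ (f-involutive (g x))
      ; fy     = inj₂ refl
      ; moves  = move x∈ z∈ x≢z (g-adjacent x) (f-adjacent (g x))
      }
      where
      z∈ : Chosen (f (g x))
      z∈ = fg-chosen x∈
      x≢z : x ≢ f (g x)
      x≢z eq = fx≢gx (trans (cong f eq) (f-involutive (g x)))

    other-side : ∀ {x y} → Defect x → Side x y → ∃ λ y′ → Side x y′ × y′ ≢ y
    other-side (_ , fx≢gx) (inj₁ refl) = _ , inj₂ refl , ≢-sym fx≢gx
    other-side (_ , fx≢gx) (inj₂ refl) = _ , inj₁ refl , fx≢gx

    record UpSide (x : Vertex) : Set where
      field
        {y}  : Vertex
        side : Side x y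
        col≡ : col y ≡ col x
        row≡ : row y ≡ suc (row x)

    upwards : ∀ {x y z} → row y ≡ suc (row x) → Move x y z → col z ≡ col x × row z ≡ 2 + row x
    upwards _ (up _ _ c r)          = c , r
    upwards r (down _ s _)          = contradiction (trans s (cong suc r)) (<⇒≢ (m<n⇒m<1+n (n<1+n _)))
    upwards r (seamʳ _ _ _ s _)     = contradiction (trans (sym s) r) (<⇒≢ (n<1+n _))
    upwards r (seamˡ _ _ _ s _)     = contradiction (trans (sym s) r) (<⇒≢ (n<1+n _))

    -- Two walls climbing beside the seam

    module Above {x} (x-defect : Defect x) (u : UpSide x) where
      open UpSide u public using (y)
      open Crossing (crossing x-defect (UpSide.side u)) public using (fy-chosen; defect; side)
        renaming (z to x′)
      private
        coordinates : col x′ ≡ col x × row x′ ≡ 2 + row x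
        coordinates = upwards (UpSide.row≡ u) (Crossing.moves (crossing x-defect (UpSide.side u)))
      col≡ : col x′ ≡ col x
      col≡ = proj₁ coordinates
      row≡ : row x′ ≡ 2 + row x
      row≡ = proj₂ coordinates

      -- The vertex s beside x′ in the seam is not a side of x′, since f would match it to a chosen vertex.
      continue : ∀ {s} → suc (col s) ≡ q → row s ≡ row x′ → ¬ Chosen (f s) → UpSide x′
      continue {s} s-col s-row fs∉ with other-side defect side
      ... | y′ , y′-side , y′≢y with crossing defect y′-side
      ...   | c with Crossing.moves c
      ...     | up c≡ r≡ _ _ = record { side = y′-side ; col≡ = c≡ ; row≡ = r≡ }
      -- Going down would use the side by which `x′` was reached.
      ...     | down c≡ r≡ _ = contradiction (vertex-≡ (trans c≡ (trans col≡ (sym (UpSide.col≡ u))))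
                  (trans (suc-injective (trans (sym r≡) row≡)) (sym (UpSide.row≡ u)))) y′≢y
      ...     | seamʳ _ c≡ _ r≡ _ = contradiction (subst (Chosen ∘ f)
                  (vertex-≡ (suc-injective (trans c≡ (sym s-col))) (trans r≡ (sym s-row)))
                  (Crossing.fy-chosen c (proj₁ defect))) fs∉
      ...     | seamˡ _ c≡ _ r≡ _ = contradiction (subst (Chosen ∘ f)
                  (vertex-≡ (suc-injective (trans c≡ (sym s-col))) (trans r≡ (sym s-row)))
                  (Crossing.fy-chosen c (proj₁ defect))) fs∉

    -- The seam is the column q - 1, between the columns q - 2 of a and 0 of b.
    record Rung (r : ℕ) : Set where
      field
        {a b s}  : Vertex
        a-defect : Defect a
        b-defect : Defect b
        a-up     : UpSide a
        b-up     : UpSide b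
        a-col    : 2 + col a ≡ q
        b-col    : col b ≡ 0
        s-col    : suc (col s) ≡ q
        a-row    : row a ≡ r
        b-row    : row b ≡ r
        s-row    : row s ≡ r
        -- Since `f` does not match `s` upwards, the vertex above `s` will not be matched downwards.
        f-turns  : ¬ (row (f s) ≡ suc r)

    -- The seam vertex `s′` above `s` lies between `A.y` and `B.y`, which `f` matches to chosen
    -- vertices, and `f-turns` excludes `s`. So `f` pairs `s′` with `s″` above it, which blocks the
    -- seam for both new defects.
    climb : ∀ {r} → Rung r → Rung (2 + r)
    climb {r} R = record
      { a-defect = A.defect
      ; b-defect = B.defect
      ; a-up     = A.continue s-col refl fs″∉
      ; b-up     = B.continue s-col (trans A-row (sym B-row)) fs″∉
      ; a-col    = trans (cong (2 +_) A.col≡) a-col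
      ; b-col    = trans B.col≡ b-col
      ; s-col    = s-col
      ; a-row    = A-row
      ; b-row    = B-row
      ; s-row    = A-row
      ; f-turns  = λ eq → <⇒≢ (m<n⇒m<1+n (n<1+n _)) (suc-injective (trans (sym s′-row) (trans (sym (cong row fs″≡s′)) eq)))
      }
      where
      open Rung R
      module A = Above a-defect a-up
      module B = Above b-defect b-up
      s′ s″ : Vertex
      s′ = proj₁ s , proj₂ A.y
      s″ = proj₁ s , proj₂ A.x′
      A-row : row A.x′ ≡ 2 + r
      A-row = trans A.row≡ (cong (2 +_) a-row)
      B-row : row B.x′ ≡ 2 + r
      B-row = trans B.row≡ (cong (2 +_) b-row)
      s′-row : row A.y ≡ suc r
      s′-row = trans (UpSide.row≡ a-up) (cong suc a-row)
      y-row : row B.y ≡ suc r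
      y-row = trans (UpSide.row≡ b-up) (cong suc b-row)
      s′∉ : ¬ Chosen s′
      s′∉ s′∈ = Chosen-1+col≢q s′∈ s-col
      fs′≢ : ∀ {y} → Chosen (f y) → f s′ ≢ y
      fs′≢ fy∈ eq = s′∉ (subst Chosen (trans (cong f (sym eq)) (f-involutive s′)) fy∈)
      fs′≢A : f s′ ≢ A.y
      fs′≢A = fs′≢ (A.fy-chosen (proj₁ a-defect))
      fs′≢B : f s′ ≢ B.y
      fs′≢B = fs′≢ (B.fy-chosen (proj₁ b-defect))
      on-B : col (f s′) ≡ 0 → row (f s′) ≡ row s′ → f s′ ≡ B.y
      on-B c r≡ = vertex-≡ (trans c (sym (trans (UpSide.col≡ b-up) b-col))) (trans r≡ (trans s′-row (sym y-row)))
      fs′≡s″ : f s′ ≡ s″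
      fs′≡s″ with neighbours (f-adjacent s′)
      ... | horizontal (fwd (step c)) _   = contradiction (trans c s-col) (<⇒≢ (col< (f s′)))
      ... | horizontal (fwd (wrap _ c)) r≡ = contradiction (on-B c r≡) fs′≢B
      ... | horizontal (bwd (step c)) r≡  = contradiction (vertex-≡ (trans (suc-injective (suc-injective
              (trans (cong suc (sym c)) (trans s-col (sym a-col))))) (sym (UpSide.col≡ a-up))) r≡) fs′≢A
      -- The seam would itself be column 0, so `f s′` would again have the coordinates of `B.y`.
      ... | horizontal (bwd (wrap c d)) r≡ =
              contradiction (on-B (trans (suc-injective (trans c (sym s-col))) d) r≡) fs′≢B
      ... | vertical (fwd (step r≡)) c    = vertex-≡ c (trans r≡ (trans (cong suc s′-row) (sym A-row)))
      -- `A.x′` lies in the row above `s′`, so that row is not the last.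
      ... | vertical (fwd (wrap r≡ _)) c  =
              contradiction (trans A-row (trans (cong suc (sym s′-row)) r≡)) (<⇒≢ (row< A.x′))
      ... | vertical (bwd (step r≡)) c    = contradiction (begin
              row (f s)      ≡⟨ cong (row ∘ f) (vertex-≡ c (suc-injective (trans (sym r≡) (trans s′-row (cong suc (sym s-row)))))) ⟨
              row (f (f s′)) ≡⟨ cong row (f-involutive s′) ⟩
              row s′         ≡⟨ s′-row ⟩
              suc r          ∎) f-turns
              where open ≡-Reasoning
      ... | vertical (bwd (wrap _ r≡)) c  = contradiction (trans (sym s′-row) r≡) 1+n≢0
      fs″≡s′ : f s″ ≡ s′
      fs″≡s′ = trans (cong f (sym fs′≡s″)) (f-involutive s′)
      fs″∉ : ¬ Chosen (f s″)
      fs″∉ = s′∉ ∘ subst Chosen fs″≡s′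

    -- Rows stay below `p`, while each climb raises `r`; `k` bounds the height still available.
    no-rung : ∀ {r} → ¬ Rung r
    no-rung {r} = descend p (m≤m+n p r)
      where
      descend : ∀ k {r} → p ≤ k + r → ¬ Rung r
      descend zero    p≤r   R = ≤⇒≯ p≤r (subst (_< p) (Rung.a-row R) (row< (Rung.a R)))
      descend (suc k) p≤k+r R = descend k (≤-trans p≤k+r (≤-trans (≤-reflexive (sym (+-suc k _)))
                                  (+-monoʳ-≤ k (n≤1+n _)))) (climb R)

    -- The lowest defects

    Lowest : Vertex → Set
    Lowest x = ∀ {w} → Defect w → row x ≤ row w

    data SeamMove (x z : Vertex) : Set where
      right : 2 + col x ≡ q → col z ≡ 0 → SeamMove x z
      left  : col x ≡ 0 → 2 + col z ≡ q → SeamMove x z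

    -- Treats both crossing directions alike; `fy-row` provides `f-turns` for the first rung.
    record SeamSide (x y : Vertex) : Set where
      field
        {z}      : Vertex
        z-defect : Defect z
        y-col    : suc (col y) ≡ q
        y-row    : row y ≡ row x
        z-row    : row z ≡ row x
        fy-row   : row (f y) ≡ row x
        seam     : SeamMove x z

    up-or-seam : ∀ {x y} → Defect x → Lowest x → Side x y → (col y ≡ col x × row y ≡ suc (row x)) ⊎ SeamSide x y
    up-or-seam {x} {y} x-defect lowest side with crossing x-defect side
    ... | c with Crossing.moves c
    ...   | up c≡ r≡ _ _ = inj₁ (c≡ , r≡)
    ...   | down _ _ r≡ = contradiction (lowest (Crossing.defect c)) (<⇒≱ (≤-trans (n≤1+n _) (≤-reflexive r≡)))
    ...   | seamʳ xc yc zc yr zr = inj₂ record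
      { z-defect = Crossing.defect c ; y-col = yc ; y-row = yr ; z-row = zr ; seam = right xc zc
      ; fy-row = Sum.[ cong row , (λ eq → trans (cong row eq) zr) ] (Crossing.fy c) }
    ...   | seamˡ xc yc zc yr zr = inj₂ record
      { z-defect = Crossing.defect c ; y-col = yc ; y-row = yr ; z-row = zr ; seam = left xc zc
      ; fy-row = Sum.[ cong row , (λ eq → trans (cong row eq) zr) ] (Crossing.fy c) }

    -- `f x` and `g x` differ, and each is the vertex above `x` or the seam vertex in its row; so
    -- they are one of each.
    corner : ∀ {x} → Defect x → Lowest x → UpSide x × ∃ (SeamSide x)
    corner {x} x-defect@(_ , fx≢gx) lowest
      with up-or-seam x-defect lowest (inj₁ refl) | up-or-seam x-defect lowest (inj₂ refl)
    ... | inj₁ (c , r) | inj₁ (c′ , r′) = contradiction (vertex-≡ (trans c (sym c′)) (trans r (sym r′))) fx≢gx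
    ... | inj₁ (c , r) | inj₂ s         = record { side = inj₁ refl ; col≡ = c ; row≡ = r } , _ , s
    ... | inj₂ s       | inj₁ (c , r)   = record { side = inj₂ refl ; col≡ = c ; row≡ = r } , _ , s
    ... | inj₂ s       | inj₂ s′        = contradiction (vertex-≡
          (suc-injective (trans (SeamSide.y-col s) (sym (SeamSide.y-col s′))))
          (trans (SeamSide.y-row s) (sym (SeamSide.y-row s′)))) fx≢gx

    first-rung : ∀ {x} → Defect x → Lowest x → Rung (row x)
    first-rung {x} x-defect lowest with corner x-defect lowest
    ... | x-up , y , s = rung seam
      where
      open SeamSide s
      z-up : UpSide z
      -- `z` shares the row of `x`, hence is lowest too.
      z-up = proj₁ (corner z-defect λ w → ≤-trans (≤-reflexive z-row) (lowest w))
      turns : row (f y) ≢ suc (row x)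
      turns eq = <⇒≢ (n<1+n _) (trans (sym fy-row) eq)
      rung : SeamMove x z → Rung (row x)
      rung (right c d) = record
        { a-defect = x-defect ; b-defect = z-defect ; a-up = x-up ; b-up = z-up
        ; a-col = c ; b-col = d ; s-col = y-col ; a-row = refl ; b-row = z-row ; s-row = y-row ; f-turns = turns }
      rung (left c d) = record
        { a-defect = z-defect ; b-defect = x-defect ; a-up = z-up ; b-up = x-up
        ; a-col = d ; b-col = c ; s-col = y-col ; a-row = z-row ; b-row = refl ; s-row = y-row ; f-turns = turns }

    -- By induction on the row no defect lies below `x`, so `x` is lowest and starts an impossible
    -- rung.
    no-defect : ∀ k {x} → row x < k → ¬ Defect x
    no-defect (suc k) {x} x<k x-defect = no-rung (first-rung x-defect λ {w} w-defect →
      ≮⇒≥ λ w<x → no-defect k (≤-trans w<x (s≤s⁻¹ x<k)) w-defect)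

    agree-chosen : ∀ {v} → Chosen v → f v ≡ g v
    agree-chosen {v} v∈ with f v ≟ᵛ g v
    ... | yes eq = eq
    ... | no neq = contradiction (v∈ , neq) (no-defect p (row< v))

    agree-everywhere : ∀ v → f v ≡ g v
    agree-everywhere v with chosen? v | chosen? (f v)
    ... | no v∉  | no fv∉  = agree v v∉ fv∉
    ... | yes v∈ | _       = agree-chosen v∈
    ... | no _   | yes fv∈ = begin
      f v         ≡⟨ g-involutive (f v) ⟨
      g (g (f v)) ≡⟨ cong g (agree-chosen fv∈) ⟨
      g (f (f v)) ≡⟨ cong g (f-involutive v) ⟩
      g v         ∎
      where open ≡-Reasoning

  -- The forcing set of an arbitrary perfect matching and its size

  module Upper {M : EdgeSet G} (perfect : IsPerfectMatching G M) where
    open Matching G {M} perfect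
    open Setoid (unorderedPair Vertex) using () renaming (_≈_ to _≈ᵉ_; sym to ≈ᵉ-sym; trans to ≈ᵉ-trans)
    open EdgeSet using (edges; adjacent; unique; size)

    Unchosen : Vertex × Vertex → Set
    Unchosen (u , v) = ¬ Chosen u × ¬ Chosen v

    unchosen? : ∀ e → Dec (Unchosen e)
    unchosen? (u , v) = ¬? (chosen? u) ×-dec ¬? (chosen? v)

    unchosen-resp : ∀ {e e′} → e ≈ᵉ e′ → Unchosen e → Unchosen e′
    unchosen-resp (inj₁ (refl , refl)) (u∉ , v∉) = u∉ , v∉
    unchosen-resp (inj₂ (refl , refl)) (u∉ , v∉) = v∉ , u∉

    S : EdgeSet G
    S = record
      { edges    = filter unchosen? (edges M)
      ; adjacent = All.filter⁺ unchosen? (adjacent M)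
      ; unique   = AllPairs.filter⁺ unchosen? (unique M)
      }

    ∈-S⁻ : ∀ {e} → _∈_ G e S → _∈_ G e M × Unchosen e
    ∈-S⁻ = Membership.∈-filter⁻ (unorderedPair Vertex) unchosen? unchosen-resp

    S-forcing : IsForcingSet G M S
    S-forcing = (λ e e∈ → proj₁ (∈-S⁻ e∈)) , forces
      where
      forces : ∀ M′ → IsPerfectMatching G M′ → _⊆_ G S M′ → _≐_ G M′ M
      forces M′ perfect′ S⊆M′ = same-partner⇒≐ G {M} {M′} perfect perfect′ agree-everywhere
        where
        module M′ = Matching G {M′} perfect′
        agree : ∀ v → ¬ Chosen v → ¬ Chosen (partner v) → partner v ≡ M′.partner v
        agree v v∉ fv∉ = sym (M′.partner-unique (S⊆M′ _
          (Membership.∈-filter⁺ (unorderedPair Vertex) unchosen? unchosen-resp (partner-∈ v) (v∉ , fv∉))))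
        open Exchange partner M′.partner partner-involutive M′.partner-involutive
               partner-adjacent M′.partner-adjacent agree

    Ends : Set
    Ends = (Fin (size S) × Fin 2) ⊎ (Index × Fin 2)

    end : Ends → Vertex
    end (inj₁ (i , zero))     = proj₁ (lookup (edges S) i)
    end (inj₁ (i , suc zero)) = proj₂ (lookup (edges S) i)
    end (inj₂ (a , zero))     = chosen a
    end (inj₂ (a , suc zero)) = partner (chosen a)

    end-∈S : ∀ i b → lookup (edges S) i ≈ᵉ (end (inj₁ (i , b)) , partner (end (inj₁ (i , b))))
    end-∈S i zero       = inj₁ (refl , sym (partner-unique (proj₁ (∈-S⁻ (∈-lookup S i)))))
    end-∈S i (suc zero) = inj₂ (sym (partner-unique (∈-swap M (proj₁ (∈-S⁻ (∈-lookup S i))))) , refl)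

    end-unchosen : ∀ i b → Unchosen (end (inj₁ (i , b)) , partner (end (inj₁ (i , b))))
    end-unchosen i b = unchosen-resp (end-∈S i b) (proj₂ (∈-S⁻ (∈-lookup S i)))

    end-disjoint : ∀ i b a c → end (inj₁ (i , b)) ≢ end (inj₂ (a , c))
    end-disjoint i b a zero       eq = proj₁ (end-unchosen i b) (a , sym eq)
    end-disjoint i b a (suc zero) eq = proj₂ (end-unchosen i b) (a , sym (trans (cong partner eq) (partner-involutive _)))

    no-loop : ∀ i → proj₁ (lookup (edges S) i) ≢ proj₂ (lookup (edges S) i)
    no-loop i eq = Graph.irrefl G (subst (Adj _) (sym eq) (∈-adjacent S (∈-lookup S i)))

    -- Edges of `S` avoid the chosen vertices, hence also their partners; by independence no partner
    -- of a chosen vertex is chosen.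
    end-injective : Injective _≡_ _≡_ end
    end-injective {inj₁ (i , b)} {inj₁ (j , c)} eq = same-edge b c eq
      (lookup-unique ≈ᵉ-sym (unique S) i j
        (≈ᵉ-trans (end-∈S i b) (≈ᵉ-trans (inj₁ (eq , cong partner eq)) (≈ᵉ-sym (end-∈S j c)))))
      where
      same-edge : ∀ {i j} b c → end (inj₁ (i , b)) ≡ end (inj₁ (j , c)) → i ≡ j → _≡_ {A = Ends} (inj₁ (i , b)) (inj₁ (j , c))
      same-edge     zero       zero       _  refl = refl
      same-edge     (suc zero) (suc zero) _  refl = refl
      same-edge {i} zero       (suc zero) eq refl = contradiction eq (no-loop i)
      same-edge {i} (suc zero) zero       eq refl = contradiction (sym eq) (no-loop i)
    end-injective {inj₁ (i , b)} {inj₂ (a , c)} eq = contradiction eq (end-disjoint i b a c)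
    end-injective {inj₂ (a , c)} {inj₁ (i , b)} eq = contradiction (sym eq) (end-disjoint i b a c)
    end-injective {inj₂ (a , zero)} {inj₂ (b , zero)} eq = cong (λ a → inj₂ (a , zero)) (chosen-injective eq)
    end-injective {inj₂ (a , suc zero)} {inj₂ (b , suc zero)} eq =
      cong (λ a → inj₂ (a , suc zero)) (chosen-injective (involutive⇒injective partner partner-involutive eq))
    end-injective {inj₂ (a , zero)} {inj₂ (b , suc zero)} eq =
      contradiction (subst (Adj _) (sym eq) (partner-adjacent (chosen b))) (Chosen-independent (b , refl) (a , refl))
    end-injective {inj₂ (a , suc zero)} {inj₂ (b , zero)} eq =
      contradiction (subst (Adj _) eq (partner-adjacent (chosen a))) (Chosen-independent (a , refl) (b , refl))

    -- The ends of `S` and the `2 m n` ends of the edges at chosen vertices are distinct among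
    -- `2 m (2 n + 1)` vertices.
    size-S : size S ≤ (n + 1) * m
    size-S = +-cancelʳ-≤ (m * n) _ _ (*-cancelʳ-≤ _ _ 2 (begin
      (size S + m * n) * 2           ≡⟨ *-distribʳ-+ 2 (size S) (m * n) ⟩
      size S * 2 + m * n * 2         ≤⟨ ↣⇒≤ Ends↔ Vertex↔ (mk↣ end-injective) ⟩
      2 * m * (2 * n + 1)            ≡⟨ vertex-count n m ⟩
      ((n + 1) * m + m * n) * 2      ∎))
      where
      open ≤-Reasoning
      Ends↔ : Ends ↔ Fin (size S * 2 + m * n * 2)
      Ends↔ = ↔-sym +↔⊎ ↔-∘ (↔-sym *↔× ⊎-↔ (↔-sym *↔× ↔-∘ (Index↔ ×-↔ ↔-id (Fin 2))))
      vertex-count : ∀ n m → 2 * m * (2 * n + 1) ≡ ((n + 1) * m + m * n) * 2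
      vertex-count = solve-∀

  -- The horizontal matching

  σ : Fin q → Fin q
  σ i = fromℕ< (swap-< m (toℕ<n i))

  toℕ-σ : ∀ i → toℕ (σ i) ≡ swap (toℕ i)
  toℕ-σ i = toℕ-fromℕ< (swap-< m (toℕ<n i))

  σ-involutive : ∀ i → σ (σ i) ≡ i
  σ-involutive i = toℕ-injective (trans (toℕ-σ (σ i)) (trans (cong swap (toℕ-σ i)) (swap-involutive (toℕ i))))

  horizontally : Vertex → Vertex
  horizontally (i , j) = σ i , j

  horizontally-adjacent : ∀ v → Adj v (horizontally v)
  horizontally-adjacent (i , j) with swap-adjacent (toℕ i)
  ... | inj₁ eq = fwd (inj₁ (≡-next (trans (toℕ-σ i) eq) , refl))
  ... | inj₂ eq = bwd (inj₁ (≡-next (trans eq (cong suc (sym (toℕ-σ i)))) , refl))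

  module H = FromInvolution G Vertex↔ horizontally (λ (i , j) → cong (_, j) (σ-involutive i)) horizontally-adjacent

  -- The horizontal matching rotated along the 4-cycle on columns 2 k, 2 k + 1 and rows j, j + 1.
  module Rotation (k : ℕ) (j : Fin p) where

    InBlock : Fin q → Set
    InBlock i = ⌊ toℕ i /2⌋ ≡ k

    j≢next : j ≢ next j
    j≢next = next-≢ (2≤2n+1 1≤n) j

    data View (v : Vertex) : Set where
      lower : InBlock (proj₁ v) → proj₂ v ≡ j → View v
      upper : InBlock (proj₁ v) → proj₂ v ≡ next j → View v
      other : (InBlock (proj₁ v) → proj₂ v ≢ j × proj₂ v ≢ next j) → View v

    view : ∀ v → View v
    view (i , j′) with ⌊ toℕ i /2⌋ ≟ k | j′ ≟ᶠ j | j′ ≟ᶠ next j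
    ... | no  i∉ | _      | _        = other λ i∈ → contradiction i∈ i∉
    ... | yes i∈ | yes ≡j | _        = lower i∈ ≡j
    ... | yes i∈ | no _   | yes ≡nxt = upper i∈ ≡nxt
    ... | yes i∈ | no ≢j  | no ≢nxt  = other λ _ → ≢j , ≢nxt

    rotateᵛ : ∀ {v} → View v → Vertex
    rotateᵛ {i , _} (lower _ _) = i , next j
    rotateᵛ {i , _} (upper _ _) = i , j
    rotateᵛ {v}     (other _)   = horizontally v

    -- Allows `rotate` to be computed from any view at hand, not only the one that `view` returns.
    rotateᵛ-irrelevant : ∀ {v} (a b : View v) → rotateᵛ a ≡ rotateᵛ b
    rotateᵛ-irrelevant (lower _ _)  (lower _ _)  = refl
    rotateᵛ-irrelevant (upper _ _)  (upper _ _)  = refl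
    rotateᵛ-irrelevant (other _)    (other _)    = refl
    rotateᵛ-irrelevant (lower _ p)  (upper _ r)  = contradiction (trans (sym p) r) j≢next
    rotateᵛ-irrelevant (upper _ p)  (lower _ r)  = contradiction (trans (sym r) p) j≢next
    rotateᵛ-irrelevant (lower i∈ p) (other i∉)   = contradiction p (proj₁ (i∉ i∈))
    rotateᵛ-irrelevant (upper i∈ p) (other i∉)   = contradiction p (proj₂ (i∉ i∈))
    rotateᵛ-irrelevant (other i∉)   (lower i∈ p) = contradiction p (proj₁ (i∉ i∈))
    rotateᵛ-irrelevant (other i∉)   (upper i∈ p) = contradiction p (proj₂ (i∉ i∈))

    rotate : Vertex → Vertex
    rotate v = rotateᵛ (view v)

    rotate-view : ∀ {v} (a : View v) → rotate v ≡ rotateᵛ a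
    rotate-view {v} = rotateᵛ-irrelevant (view v)

    rotate-involutive : ∀ v → rotate (rotate v) ≡ v
    rotate-involutive v@(i , _) with view v
    ... | lower i∈ refl = rotate-view (upper i∈ refl)
    ... | upper i∈ refl = rotate-view (lower i∈ refl)
    ... | other i∉      = trans (rotate-view (other (i∉ ∘ σ-InBlock⁻))) (cong (_, _) (σ-involutive i))
      where
      σ-InBlock⁻ : InBlock (σ i) → InBlock i
      σ-InBlock⁻ = trans (trans (sym (half-swap (toℕ i))) (cong ⌊_/2⌋ (sym (toℕ-σ i))))

    rotate-adjacent : ∀ v → Adj v (rotate v)
    rotate-adjacent v with view v
    ... | lower _ refl = fwd (inj₂ (refl , refl))
    ... | upper _ refl = bwd (inj₂ (refl , refl))
    ... | other _      = horizontally-adjacent v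

    module R = FromInvolution G Vertex↔ rotate rotate-involutive rotate-adjacent

  -- The lower bound for the horizontal matching

  corner-vertex : Fin m → Fin p → Vertex
  corner-vertex k j = fromℕ< (*-monoʳ-< 2 (toℕ<n k)) , j

  horizontal-edge : Fin m → Fin p → Vertex × Vertex
  horizontal-edge k j = corner-vertex k j , horizontally (corner-vertex k j)

  col-corner : ∀ k j → col (corner-vertex k j) ≡ 2 * toℕ k
  col-corner k j = toℕ-fromℕ< _

  open Setoid (unorderedPair Vertex) using () renaming (_≈_ to _≈ᵉ_; sym to ≈ᵉ-sym; trans to ≈ᵉ-trans)

  in-block-edge : ∀ k v → ⌊ col v /2⌋ ≡ toℕ k → (v , horizontally v) ≈ᵉ horizontal-edge k (proj₂ v)
  in-block-edge k v@(i , j) i∈ with half⁻¹ (toℕ i)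
  ... | inj₁ eq = inj₁ (v≡ , cong horizontally v≡)
    where
    v≡ : v ≡ corner-vertex k j
    v≡ = vertex-≡ (trans eq (trans (cong (2 *_) i∈) (sym (col-corner k j)))) refl
  ... | inj₂ eq = inj₂ (v≡ , trans (cong horizontally v≡) (cong (_, j) (σ-involutive _)))
    where
    v≡ : v ≡ horizontally (corner-vertex k j)
    v≡ = vertex-≡ (trans eq (trans (cong (swap ∘ (2 *_)) i∈)
           (trans (cong swap (sym (col-corner k j))) (sym (toℕ-σ _))))) refl

  horizontal-edge-injective : ∀ k l {i j} → horizontal-edge k i ≈ᵉ horizontal-edge l j → k ≡ l × i ≡ j
  horizontal-edge-injective k l {i} {j} (inj₁ (eq , _)) =
      toℕ-injective (*-cancelˡ-≡ _ _ 2 (trans (sym (col-corner k i)) (trans (cong col eq) (col-corner l j))))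
    , cong proj₂ eq
  horizontal-edge-injective k l {i} {j} (inj₂ (eq , _)) = contradiction
    (trans (sym (col-corner k i)) (trans (cong col eq) (trans (toℕ-σ _)
      (trans (cong swap (col-corner l j)) (swap-even (toℕ l))))))
    (even≢odd (toℕ k) (toℕ l))

  module Lower (S : EdgeSet G) (S-forcing : IsForcingSet G H.matching S) where

    Covered : Fin m → Fin p → Set
    Covered k j = _∈_ G (horizontal-edge k j) S

    covered? : ∀ k j → Dec (Covered k j)
    covered? k j = Any.any? (λ (u , v) → ((_ ≟ᵛ u) ×-dec (_ ≟ᵛ v)) ⊎-dec ((_ ≟ᵛ v) ×-dec (_ ≟ᵛ u))) (EdgeSet.edges S)

    -- Were both horizontal edges of the 4-cycle missing from `S`, rotating along it would keep `S`;
    -- forcing would then make the rotation trivial, although it moves the corner to another row.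
    covers : ∀ k j → Covered k j ⊎ Covered k (next j)
    covers k j with covered? k j | covered? k (next j)
    ... | yes j∈ | _       = inj₁ j∈
    ... | no _   | yes j′∈ = inj₂ j′∈
    ... | no j∉  | no j′∉  = contradiction (cong proj₂ stays) (≢-sym j≢next)
      where
      open Rotation (toℕ k) j
      S⊆R : _⊆_ G S R.matching
      S⊆R (u , w) e∈ with view u | H.matched-unique (proj₁ S-forcing _ e∈)
      ... | lower u∈ refl | refl = contradiction (Any.map (≈ᵉ-trans (≈ᵉ-sym (in-block-edge k u u∈))) e∈) j∉
      ... | upper u∈ refl | refl = contradiction (Any.map (≈ᵉ-trans (≈ᵉ-sym (in-block-edge k u u∈))) e∈) j′∉
      ... | other u∉      | refl = subst (λ w → _∈_ G (u , w) R.matching) (rotate-view (other u∉)) (R.matched u)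
      v : Vertex
      v = corner-vertex k j
      stays : (proj₁ v , next j) ≡ horizontally v
      stays = begin
        proj₁ v , next j                           ≡⟨ rotate-view (lower
                                                        (trans (cong ⌊_/2⌋ (col-corner k j)) (half-even (toℕ k))) refl) ⟨
        rotate v                                   ≡⟨ ≐⇒same-partner G {H.matching} {R.matching} H.perfect R.perfect
                                                        (proj₂ S-forcing R.matching R.perfect S⊆R) v ⟨
        horizontally v                             ∎
        where open ≡-Reasoning

    -- Each of the `m` column pairs contributes an edge for each of `n + 1` keys. Equal edges lie in
    -- the same pair and row, so their keys agree.
    size-S : (n + 1) * m ≤ EdgeSet.size S
    size-S = ∈⇒≤size S (↔-sym *↔×) edge edge∈ edge-injective
      where
      cover : ∀ k → ∃ λ (key : Fin p → ℕ) → ∀ (l : Fin (n + 1)) → ∃ λ j → Covered k j × key j ≡ toℕ l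
      cover k = odd-cycle-cover n (covered? k) (covers k)
      edge : Fin (n + 1) × Fin m → Vertex × Vertex
      edge (l , k) = horizontal-edge k (proj₁ (proj₂ (cover k) l))
      edge∈ : ∀ a → _∈_ G (edge a) S
      edge∈ (l , k) = proj₁ (proj₂ (proj₂ (cover k) l))
      edge-injective : ∀ {a b} → edge a ≈ᵉ edge b → a ≡ b
      edge-injective {l , k} {l′ , k′} eq with horizontal-edge-injective k k′ eq
      ... | refl , j≡j′ = cong (_, k) (toℕ-injective
        (trans (sym (proj₂ (proj₂ (proj₂ (cover k) l)))) (trans (cong (proj₁ (cover k)) j≡j′)
          (proj₂ (proj₂ (proj₂ (cover k) l′))))))

-- Combining the two bounds

theorem5p2 : (n m : ℕ) (1≤n : 1 ≤ n) (2≤m : 2 ≤ m) →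
    IsMaximumForcingNumber (T (2 * n + 1) (2 * m) (2≤2n+1 1≤n) (2≤2m 2≤m)) ((n + 1) * m)
theorem5p2 n m 1≤n 2≤m = (H.matching , H.perfect , attained , minimal) , bound
  where
  open Grid n m 1≤n 2≤m
  minimal : ∀ k → (∃ λ S → IsForcingSet G H.matching S × EdgeSet.size S ≡ k) → (n + 1) * m ≤ k
  minimal k (S , S-forcing , refl) = Lower.size-S S S-forcing
  attained : ∃ λ S → IsForcingSet G H.matching S × EdgeSet.size S ≡ (n + 1) * m
  attained = U.S , U.S-forcing , ≤-antisym U.size-S (Lower.size-S U.S U.S-forcing)
    where module U = Upper {H.matching} H.perfect
  bound : ∀ k → (∃ λ M → IsPerfectMatching G M × IsForcingNumber G M k) → k ≤ (n + 1) * m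
  bound k (M , perfect , _ , minimal) = ≤-trans (minimal _ (U.S , U.S-forcing , refl)) U.size-S
    where module U = Upper {M} perfect
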